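{- For any tree $T$ of order $n\geq 5$, we have $\mathrm{sep}(T)\leq n-s(T)$, where $s(T)$ is the number of support vertices of $T$.
   Context: A leaf of a tree is a vertex of degree $1$; a support vertex is a vertex adjacent to at least one leaf; $s(T)$ is the number of support vertices of $T$. $N[x]$ denotes the closed neighborhood of $x$. For a twin-free graph $G$ (no two distinct vertices have the same closed neighborhood; this holds for every tree on at least $3$ vertices), $\mathrm{sep}(G)$ is the smallest size of a set $S\subseteq V(G)$ such that $N[x]\cap S\neq N[y]\cap S$ for all distinct vertices $x,y$ of $G$. -}

module Defs where

open import Data.Bool.Properties as Bool using ()
open import Data.Fin.Base using (Fin)
open import Data.Fin.Properties using (_≟_; all?; any?)
open import Data.Fin.Subset using (Subset; inside; outside; ⊤; ⁅_⁆; _∪_; _∩_; ∣_∣)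
open import Data.Fin.Subset.Properties using (∩-identityʳ; ∣⊤∣≡n)
open import Data.List.Base using (List; []; _∷_; [_]; _++_; length; map; filter)
open import Data.List.Extrema.Nat using (min; argmin-sel; min≤v⁺)
open import Data.List.Membership.Propositional using (_∈_)
open import Data.List.Membership.Propositional.Properties
  using (∈-map⁺; ∈-map⁻; ∈-++⁺ˡ; ∈-++⁺ʳ; ∈-filter⁺; ∈-filter⁻)
open import Data.List.Relation.Unary.Any as Any using (here)
open import Data.List.Relation.Unary.Linked using (Linked)
open import Data.List.Relation.Unary.Unique.Propositional using (Unique)
open import Data.Nat.Base using (ℕ; zero; suc; _≤_)
open import Data.Nat.Properties as ℕ using (≤-reflexive)
open import Data.Product.Base using (∃; _×_; _,_)
open import Data.Sum.Base using (inj₁; inj₂)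
open import Data.Vec.Base using ([]; _∷_; tabulate)
open import Data.Vec.Properties using (≡-dec)
open import Function.Base using (id)
open import Level using (0ℓ)
open import Relation.Binary.Core using (Rel)
open import Relation.Binary.Construct.Closure.ReflexiveTransitive using (Star)
open import Relation.Binary.Definitions using (Decidable; Symmetric)
open import Relation.Binary.PropositionalEquality using (_≡_; _≢_; refl; sym; trans; subst₂)
open import Relation.Nullary using (¬_; does; ¬?; _×-dec_; _→-dec_)
import Relation.Unary as U

-- Finite simple graphs with vertex set Fin n.
record Graph (n : ℕ) : Set₁ where
  field
    Adj        : Rel (Fin n) 0ℓ
    adj?       : Decidable Adj
    adj-sym    : Symmetric Adj
    adj-irrefl : ∀ x → ¬ Adj x x

comprehension : ∀ {n} {P : Fin n → Set} → U.Decidable P → Subset n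
comprehension P? = tabulate (λ x → does (P? x))

subsets : ∀ n → List (Subset n)
subsets zero    = [ [] ]
subsets (suc n) = map (inside ∷_) (subsets n) ++ map (outside ∷_) (subsets n)

module _ {n : ℕ} (G : Graph n) where
  open Graph G

  Connected : Set
  Connected = ∀ x y → Star Adj x y

  -- The closed walk v, vs, v; its vertices v ∷ vs are distinct and number at least 3.
  IsCycle : Fin n → List (Fin n) → Set
  IsCycle v vs = 2 ≤ length vs × Unique (v ∷ vs) × Linked Adj (v ∷ vs ++ [ v ])

  Acyclic : Set
  Acyclic = ∀ v vs → ¬ IsCycle v vs

  record IsTree : Set where
    field
      connected : Connected
      acyclic   : Acyclic

  N⟨_⟩ : Fin n → Subset n
  N⟨ x ⟩ = comprehension (adj? x)

  N[_] : Fin n → Subset n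
  N[ x ] = ⁅ x ⁆ ∪ N⟨ x ⟩

  degree : Fin n → ℕ
  degree x = ∣ N⟨ x ⟩ ∣

  Leaf : Fin n → Set
  Leaf x = degree x ≡ 1

  Support : Fin n → Set
  Support x = ∃ λ y → Adj x y × Leaf y

  support? : U.Decidable Support
  support? x = any? (λ y → adj? x y ×-dec degree y ℕ.≟ 1)

  s : ℕ
  s = ∣ comprehension support? ∣

  TwinFree : Set
  TwinFree = ∀ x y → x ≢ y → N[ x ] ≢ N[ y ]

  Separating : Subset n → Set
  Separating S = ∀ x y → x ≢ y → N[ x ] ∩ S ≢ N[ y ] ∩ S

  separating? : U.Decidable Separating
  separating? S = all? λ x → all? λ y →
    ¬? (x ≟ y) →-dec ¬? (≡-dec Bool._≟_ (N[ x ] ∩ S) (N[ y ] ∩ S))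

  -- The first argument of min is a default, which matters only if there is no
  -- separating set: a graph with twins gets the value n. For twin-free graphs
  -- the minimum is attained, see sep-attained and sep-minimal.
  sep : ℕ
  sep = min n (map ∣_∣ (filter separating? (subsets n)))

∈-subsets : ∀ {n} (S : Subset n) → S ∈ subsets n
∈-subsets []            = here refl
∈-subsets (inside  ∷ S) = ∈-++⁺ˡ (∈-map⁺ (inside ∷_) (∈-subsets S))
∈-subsets {suc n} (outside ∷ S) =
  ∈-++⁺ʳ (map (inside ∷_) (subsets n)) (∈-map⁺ (outside ∷_) (∈-subsets S))

module _ {n : ℕ} (G : Graph n) where

  sep-minimal : ∀ S → Separating G S → sep G ≤ ∣ S ∣
  sep-minimal S sepS = min≤v⁺ {v = ∣ S ∣} n sizes
    (inj₂ (Any.map (λ eq → ≤-reflexive (sym eq))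
      (∈-map⁺ ∣_∣ (∈-filter⁺ (separating? G) (∈-subsets S) sepS))))
    where sizes = map ∣_∣ (filter (separating? G) (subsets n))

  sep-attained : TwinFree G → ∃ λ S → Separating G S × ∣ S ∣ ≡ sep G
  sep-attained tf with argmin-sel id n (map ∣_∣ (filter (separating? G) (subsets n)))
  ... | inj₁ sep≡n = ⊤ , full , trans (∣⊤∣≡n n) (sym sep≡n)
    where
    full : Separating G ⊤
    full x y x≢y eq =
      tf x y x≢y (subst₂ _≡_ (∩-identityʳ (N[_] G x)) (∩-identityʳ (N[_] G y)) eq)
  ... | inj₂ sep∈ with ∈-map⁻ ∣_∣ sep∈
  ...   | S , S∈ , eq with ∈-filter⁻ (separating? G) {xs = subsets n} S∈
  ...     | _ , sepS = S , sepS , sym eq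

{-# OPTIONS --safe #-}

-- Let D consist of one leaf for every support vertex. The complement of D
-- separates. Suppose that x and y are distinct and that N[x] and N[y] differ
-- only inside D. If x and y are not adjacent, both lie in D, and they have the
-- same neighbour (a support vertex is not a leaf), so x = y. If they are
-- adjacent, they have no common neighbour, so each further neighbour of x or y
-- is the chosen leaf of x or y, and the whole tree has at most four vertices.
module Submission where

open import Defs
open import Data.Nat.Base using (ℕ; _≤_; _∸_)

open import Data.Fin.Base using (Fin; zero; suc)
open import Data.Fin.Properties using (_≟_; any?; injective⇒≤; suc-injective)
open import Data.Fin.Subset using (Subset; inside; outside; ∁; _∩_; ∣_∣; _-_; _∈_)
open import Data.Fin.Subset.Properties
  using (x∈⁅x⁆; x∈⁅y⁆⇒x≡y; x∈p∪q⁺; x∈p∪q⁻; x∈p∩q⁺; x∈p∩q⁻; x∉p⇒x∈∁p; ∣∁p∣≡n∸∣p∣;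
         x∈p⇒∣p-x∣<∣p∣; x∈p∧x≢y⇒x∈p-y)
open import Data.List.Base using (List; []; _∷_; length)
open import Data.List.Membership.Propositional as List using ()
open import Data.List.Membership.Setoid.Properties using (index-injective)
open import Data.List.Relation.Unary.All using ([]; _∷_)
open import Data.List.Relation.Unary.AllPairs using ([]; _∷_)
open import Data.List.Relation.Unary.Any as Any using (here; there)
open import Data.List.Relation.Unary.Linked using ([-]; _∷_)
open import Data.Nat.Base using (z≤n; s≤s)
open import Data.Nat.Properties
  using (≤-trans; ≤-reflexive; <-≤-trans; <-irrefl; n≮0; n<1⇒n≡0; ∸-monoʳ-≤)
open import Data.Product.Base using (∃; _×_; _,_)
open import Data.Sum.Base using (_⊎_; inj₁; inj₂)
open import Data.Vec.Base using ([]; _∷_; here; there)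
open import Data.Vec.Properties using ([]=⇒lookup; lookup⇒[]=; lookup∘tabulate)
open import Function.Base using (_∘_)
open import Relation.Binary.Construct.Closure.ReflexiveTransitive using (Star; ε; _◅_)
open import Relation.Binary.PropositionalEquality
  using (_≡_; _≢_; refl; sym; trans; cong; subst; setoid)
open import Relation.Nullary
  using (¬_; yes; no; does; _×-dec_; contradiction; decidable-stable)
open import Relation.Nullary.Decidable using (dec-true)
import Relation.Unary as U

private variable
  m n : ℕ

∈-comprehension⁺ : {P : Fin n → Set} (P? : U.Decidable P) → ∀ {x} → P x → x ∈ comprehension P?
∈-comprehension⁺ P? {x} px =
  lookup⇒[]= x _ (trans (lookup∘tabulate (does ∘ P?) x) (dec-true (P? x) px))

∈-comprehension⁻ : {P : Fin n → Set} (P? : U.Decidable P) → ∀ {x} → x ∈ comprehension P? → P x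
∈-comprehension⁻ P? {x} x∈ with P? x | trans (sym (lookup∘tabulate (does ∘ P?) x)) ([]=⇒lookup x∈)
... | yes px | _ = px
... | no _   | ()

-- Induction on `p`: each member takes its image out of `q`, and injectivity keeps the later images
-- inside what remains.
injectiveOn⇒∣p∣≤∣q∣ : (p : Subset m) (q : Subset n) (f : Fin m → Fin n) →
  (∀ {x} → x ∈ p → f x ∈ q) →
  (∀ {x y} → x ∈ p → y ∈ p → f x ≡ f y → x ≡ y) →
  ∣ p ∣ ≤ ∣ q ∣
injectiveOn⇒∣p∣≤∣q∣ [] q f maps inj = z≤n
injectiveOn⇒∣p∣≤∣q∣ (outside ∷ p) q f maps inj =
  injectiveOn⇒∣p∣≤∣q∣ p q (f ∘ suc) (maps ∘ there)
    (λ x∈ y∈ eq → suc-injective (inj (there x∈) (there y∈) eq))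
injectiveOn⇒∣p∣≤∣q∣ (inside ∷ p) q f maps inj =
  ≤-trans (s≤s (injectiveOn⇒∣p∣≤∣q∣ p (q - f zero) (f ∘ suc)
    (λ x∈ → x∈p∧x≢y⇒x∈p-y (maps (there x∈)) (λ eq → contradiction (inj (there x∈) here eq) λ ()))
    (λ x∈ y∈ eq → suc-injective (inj (there x∈) (there y∈) eq))))
  (x∈p⇒∣p-x∣<∣p∣ (maps here))

∣p∣≡1⇒unique : (p : Subset n) → ∣ p ∣ ≡ 1 → ∀ {x y} → x ∈ p → y ∈ p → x ≡ y
-- If `x` and `y` differ, `p - y` has size 0 yet still contains `x`.
∣p∣≡1⇒unique p ∣p∣≡1 {x} {y} x∈p y∈p = decidable-stable (x ≟ y) λ x≢y →
  n≮0 (<-≤-trans (x∈p⇒∣p-x∣<∣p∣ (x∈p∧x≢y⇒x∈p-y x∈p x≢y))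
    (≤-reflexive (n<1⇒n≡0 (<-≤-trans (x∈p⇒∣p-x∣<∣p∣ y∈p) (≤-reflexive ∣p∣≡1)))))

covered⇒≤length : (xs : List (Fin n)) → (∀ v → v List.∈ xs) → n ≤ length xs
covered⇒≤length {n} xs cover = injective⇒≤ {f = λ v → Any.index (cover v)}
  λ {v} {w} → index-injective (setoid (Fin n)) (cover v) (cover w)

module _ (G : Graph n) where
  open Graph G

  ∈-N[]⁻ : ∀ {x v} → v ∈ N[_] G x → v ≡ x ⊎ Adj x v
  ∈-N[]⁻ {x} v∈ with x∈p∪q⁻ _ _ v∈
  ... | inj₁ v∈⁅x⁆ = inj₁ (x∈⁅y⁆⇒x≡y x v∈⁅x⁆)
  ... | inj₂ v∈N   = inj₂ (∈-comprehension⁻ (adj? x) v∈N)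

  ∈-N[]⁺ : ∀ {x v} → v ≡ x ⊎ Adj x v → v ∈ N[_] G x
  ∈-N[]⁺ {x} (inj₁ refl) = x∈p∪q⁺ (inj₁ (x∈⁅x⁆ x))
  ∈-N[]⁺ {x} (inj₂ x~v)  = x∈p∪q⁺ (inj₂ (∈-comprehension⁺ (adj? x) x~v))

  leaf-unique : ∀ {x a b} → Leaf G x → Adj x a → Adj x b → a ≡ b
  leaf-unique {x} leaf x~a x~b =
    ∣p∣≡1⇒unique _ leaf (∈-comprehension⁺ (adj? x) x~a) (∈-comprehension⁺ (adj? x) x~b)

  acyclic⇒triangle-free : Acyclic G → ∀ {x y z} → Adj x y → Adj y z → ¬ Adj z x
  acyclic⇒triangle-free acyclic {x} {y} {z} x~y y~z z~x = acyclic x (y ∷ z ∷ [])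
    ( s≤s (s≤s z≤n)
    , (adj⇒≢ x~y ∷ adj⇒≢ (adj-sym z~x) ∷ []) ∷ (adj⇒≢ y~z ∷ []) ∷ [] ∷ []
    , x~y ∷ y~z ∷ z~x ∷ [-])
    where
    adj⇒≢ : ∀ {u v} → Adj u v → u ≢ v
    adj⇒≢ u~v refl = adj-irrefl _ u~v

  -- A list closed under adjacency absorbs every walk from `x`, hence all vertices. This turns a
  -- local description of neighbourhoods into a bound on `n`.
  closed⇒≤length : Connected G → ∀ x {xs} → x List.∈ xs →
    (∀ {u v} → u List.∈ xs → Adj u v → v List.∈ xs) → n ≤ length xs
  closed⇒≤length connected x {xs} x∈xs closed = covered⇒≤length xs (λ v → reach x∈xs (connected x v))
    where
    reach : ∀ {u v} → u List.∈ xs → Star Adj u v → v List.∈ xs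
    reach u∈xs ε           = u∈xs
    reach u∈xs (u~w ◅ w⋆v) = reach (closed u∈xs u~w) w⋆v

  adjacent-leaves⇒≤2 : Connected G → ∀ {x y} → Adj x y → Leaf G x → Leaf G y → n ≤ 2
  adjacent-leaves⇒≤2 connected {x} {y} x~y leaf-x leaf-y =
    closed⇒≤length connected x (here refl) closed
    where
    closed : ∀ {u v} → u List.∈ x ∷ y ∷ [] → Adj u v → v List.∈ x ∷ y ∷ []
    closed (here refl)         u~v = there (here (leaf-unique leaf-x u~v x~y))
    closed (there (here refl)) u~v = here (leaf-unique leaf-y u~v (adj-sym x~y))

  -- Junk value: the vertex itself when it is not a support vertex.
  leafOf : Fin n → Fin n
  leafOf x with support? G x
  ... | yes (y , _) = y
  ... | no _        = x

  leafOf-support : ∀ {x} → Support G x → Adj x (leafOf x) × Leaf G (leafOf x)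
  leafOf-support {x} supp with support? G x
  ... | yes (_ , prop) = prop
  ... | no ¬supp       = contradiction supp ¬supp

  -- The second alternative covers the junk value, so that no support hypothesis on `x` is required.
  leafOf-adj : ∀ {x v} → Adj (leafOf x) v → v ≡ x ⊎ Adj x v
  leafOf-adj {x} ℓ~v with support? G x
  ... | yes (_ , x~ℓ , leaf) = inj₁ (leaf-unique leaf ℓ~v (adj-sym x~ℓ))
  ... | no _                 = inj₂ ℓ~v

  leafOf-unique : ∀ {a x} → Support G a → Adj x (leafOf a) → x ≡ a
  leafOf-unique supp x~ℓ with leafOf-support supp
  ... | a~ℓ , leaf = leaf-unique leaf (adj-sym x~ℓ) (adj-sym a~ℓ)

  Chosen : Fin n → Set
  Chosen v = ∃ λ x → Support G x × leafOf x ≡ v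

  chosen? : U.Decidable Chosen
  chosen? v = any? λ x → support? G x ×-dec leafOf x ≟ v

  chosen : Subset n
  chosen = comprehension chosen?

  s≤∣chosen∣ : s G ≤ ∣ chosen ∣
  s≤∣chosen∣ = injectiveOn⇒∣p∣≤∣q∣ _ _ leafOf
    (λ {x} x∈ → ∈-comprehension⁺ chosen? (x , supp x∈ , refl))
    -- Here `x` is adjacent to `leafOf x`, which equals `leafOf y`, a leaf whose only neighbour is
    -- `y`.
    (λ {x} x∈ y∈ eq →
      leafOf-unique (supp y∈)
        (subst (Adj x) eq (let x~ℓ , _ = leafOf-support (supp x∈) in x~ℓ)))
    where
    supp : ∀ {x} → x ∈ comprehension (support? G) → Support G x
    supp = ∈-comprehension⁻ (support? G)

  chosen-adj : ∀ {x u} → Adj x u → Chosen u → u ≡ leafOf x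
  chosen-adj x~u (a , supp , refl) = cong leafOf (sym (leafOf-unique supp x~u))

  -- One half of an equality of traces on `∁ chosen`, with closed neighbourhoods unfolded into
  -- disjunctions.
  _⊑_ : Fin n → Fin n → Set
  x ⊑ y = ∀ {v} → v ≡ x ⊎ Adj x v → ¬ Chosen v → v ≡ y ⊎ Adj y v

  N∩∁chosen⇒⊑ : ∀ {x y} → N[_] G x ∩ ∁ chosen ≡ N[_] G y ∩ ∁ chosen → x ⊑ y
  N∩∁chosen⇒⊑ {x} {y} eq {v} v∈Nx ¬chosen
    with x∈p∩q⁻ _ _ (subst (v ∈_) eq
           (x∈p∩q⁺ (∈-N[]⁺ v∈Nx , x∉p⇒x∈∁p (¬chosen ∘ ∈-comprehension⁻ chosen?))))
  ... | v∈Ny , _ = ∈-N[]⁻ v∈Ny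

  module _ (tree : IsTree G) (5≤n : 5 ≤ n) where
    open IsTree tree

    -- A chosen vertex is a leaf; if it also supported a leaf, these two adjacent leaves would be
    -- the whole tree.
    support⇒¬chosen : ∀ {a} → Support G a → ¬ Chosen a
    support⇒¬chosen (u , a~u , leaf-u) (b , supp-b , refl) with leafOf-support supp-b
    ... | _ , leaf-a =
      <-irrefl refl (<-≤-trans (s≤s (s≤s (s≤s z≤n)))
        (≤-trans 5≤n (adjacent-leaves⇒≤2 connected a~u leaf-a leaf-u)))

    -- Were `v` not chosen, it would lie in the closed neighbourhood of `y` and close a triangle
    -- with `x` and `y`. So it is chosen, and its only neighbour `x` determines it.
    ⊑-adjacent : ∀ {x y v} → x ⊑ y → Adj x y → Adj x v → v ≢ y → v ≡ leafOf x
    ⊑-adjacent {v = v} x⊑y x~y x~v v≢y =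
      chosen-adj x~v (decidable-stable (chosen? v) λ ¬chosen → case (x⊑y (inj₂ x~v) ¬chosen))
      where
      case : ¬ (v ≡ _ ⊎ Adj _ v)
      case (inj₁ v≡y) = v≢y v≡y
      case (inj₂ y~v) = acyclic⇒triangle-free acyclic x~y y~v (adj-sym x~v)

    adjacent-separated : ∀ {x y} → Adj x y → x ⊑ y → ¬ y ⊑ x
    adjacent-separated {x} {y} x~y x⊑y y⊑x =
      <-irrefl refl (≤-trans 5≤n (closed⇒≤length connected x (here refl) closed))
      where
      -- Repetitions, which occur when `leafOf` takes its junk value, are harmless: only the length
      -- 4 matters, against `5 ≤ n`.
      vs : List (Fin n)
      vs = x ∷ y ∷ leafOf x ∷ leafOf y ∷ []

      N[x]⊆vs : ∀ {v} → v ≡ x ⊎ Adj x v → v List.∈ vs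
      N[x]⊆vs (inj₁ v≡x) = here v≡x
      N[x]⊆vs {v} (inj₂ x~v) with v ≟ y
      ... | yes v≡y = there (here v≡y)
      ... | no v≢y  = there (there (here (⊑-adjacent x⊑y x~y x~v v≢y)))

      N[y]⊆vs : ∀ {v} → v ≡ y ⊎ Adj y v → v List.∈ vs
      N[y]⊆vs (inj₁ v≡y) = there (here v≡y)
      N[y]⊆vs {v} (inj₂ y~v) with v ≟ x
      ... | yes v≡x = here v≡x
      ... | no v≢x  = there (there (there (here (⊑-adjacent y⊑x (adj-sym x~y) y~v v≢x))))

      closed : ∀ {u v} → u List.∈ vs → Adj u v → v List.∈ vs
      closed (here refl)                         u~v = N[x]⊆vs (inj₂ u~v)
      closed (there (here refl))                 u~v = N[y]⊆vs (inj₂ u~v)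
      closed (there (there (here refl)))         u~v = N[x]⊆vs (leafOf-adj u~v)
      closed (there (there (there (here refl)))) u~v = N[y]⊆vs (leafOf-adj u~v)

    -- `x` belongs to its own closed neighbourhood but not to that of `y`, so only membership in
    -- `chosen` can hide it.
    nonadjacent-chosen : ∀ {x y} → x ≢ y → ¬ Adj y x → x ⊑ y → Chosen x
    nonadjacent-chosen {x} x≢y y≁x x⊑y = decidable-stable (chosen? x) λ ¬chosen →
      case (x⊑y (inj₁ refl) ¬chosen)
      where
      case : ¬ (x ≡ _ ⊎ Adj _ x)
      case (inj₁ x≡y) = x≢y x≡y
      case (inj₂ y~x) = y≁x y~x

    nonadjacent-separated : ∀ {x y} → x ≢ y → ¬ Adj x y → x ⊑ y → ¬ y ⊑ x
    nonadjacent-separated {x} {y} x≢y x≁y x⊑y y⊑x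
      with nonadjacent-chosen x≢y (x≁y ∘ adj-sym) x⊑y
         | nonadjacent-chosen (x≢y ∘ sym) x≁y y⊑x
    ... | a , supp-a , refl | chosen-y
      with leafOf-support supp-a
    ... | a~x , _
      -- The support vertex `a` of `x` is not chosen, so it is seen from `y` too. It cannot be `y`,
      -- so it is a neighbour of `y`, and `y` is then the leaf chosen for `a`, namely `x`.
      with x⊑y (inj₂ (adj-sym a~x)) (support⇒¬chosen supp-a)
    ... | inj₁ refl = x≁y (adj-sym a~x)
    ... | inj₂ y~a  = x≢y (sym (chosen-adj (adj-sym y~a) chosen-y))

    ∁chosen-separating : Separating G (∁ chosen)
    ∁chosen-separating x y x≢y eq with adj? x y
    ... | yes x~y = adjacent-separated x~y (N∩∁chosen⇒⊑ eq) (N∩∁chosen⇒⊑ (sym eq))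
    ... | no x≁y  = nonadjacent-separated x≢y x≁y (N∩∁chosen⇒⊑ eq) (N∩∁chosen⇒⊑ (sym eq))

theorem18 : ∀ (n : ℕ) (T : Graph n) → IsTree T → 5 ≤ n → sep T ≤ n ∸ s T
theorem18 n T tree 5≤n = ≤-trans
  (sep-minimal T (∁ (chosen T)) (∁chosen-separating T tree 5≤n))
  (≤-trans (≤-reflexive (∣∁p∣≡n∸∣p∣ (chosen T))) (∸-monoʳ-≤ n (s≤∣chosen∣ T)))
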